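{- For all $P \subseteq \mathbb{R}^2$, $\operatorname{opx}(n, P)$ is super-additive, i.e. $\operatorname{opx}(m+n, P) \ge \operatorname{opx}(m, P) + \operatorname{opx}(n, P)$ for all real $m, n > 0$.
   Context: Containment for subsets of the plane: for $P, S \subseteq \mathbb{R}^2$, let $X_P, Y_P$ be the sets of $x$-coordinates and $y$-coordinates of points of $P$, and $X_S, Y_S$ likewise for $S$. $S$ contains $P$ if there exist functions $f_X: X_P \to X_S$ and $f_Y: Y_P \to Y_S$ such that (1) $\frac{f_X(x_0)-f_X(x_1)}{x_0-x_1} \ge 1$ for all $x_0 > x_1$ in $X_P$; (2) $\frac{f_Y(y_0)-f_Y(y_1)}{y_0-y_1} \ge 1$ for all $y_0 > y_1$ in $Y_P$; (3) $(f_X(x), f_Y(y)) \in S$ for all $(x,y) \in P$. Otherwise $S$ is $P$-free. For real $n > 0$, $\operatorname{opx}(n,P)$ is the supremum of the Lebesgue measure $\mu_2(S)$ over all open $P$-free subsets $S \subseteq [0,n]^2$. -}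

module Defs where

open import Level using (0ℓ; Setω)
open import Algebra.Bundles using (CommutativeRing)
open import Axiom.ExcludedMiddle using (ExcludedMiddle)
open import Data.Empty using (⊥-elim)
open import Data.Nat.Base using (ℕ; zero; suc)
open import Data.Product.Base using (Σ; Σ-syntax; ∃; ∃-syntax; _×_; _,_; proj₁; proj₂)
open import Data.Sum.Base using (_⊎_; inj₁; inj₂)
open import Function.Bundles using (Func)
open import Relation.Binary.Bundles using (Setoid)
open import Relation.Binary.Core using (Rel)
open import Relation.Binary.PropositionalEquality.Core using (_≡_; subst)
open import Relation.Binary.Structures using (IsTotalOrder)
import Relation.Binary.Construct.NonStrictToStrict as NonStrictToStrict
import Relation.Binary.Construct.On as On
open import Relation.Nullary using (¬_; Dec; yes; no)
open import Relation.Unary using (Pred; _∈_; _⊆_)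

-- The real numbers, axiomatised as a Dedekind-complete ordered field.
-- `lub` ranges over predicates of every level, as subsets do classically;
-- this is what places the record in Setω.
record Reals : Setω where
  field
    commutativeRing : CommutativeRing 0ℓ 0ℓ

  open CommutativeRing commutativeRing public
    hiding (refl; sym; trans; reflexive; isEquivalence)
    renaming (Carrier to ℝ)

  infix  4 _≤_
  infix  8 _⁻¹

  field
    _≤_          : Rel ℝ 0ℓ
    isTotalOrder : IsTotalOrder _≈_ _≤_
    +-monoˡ-≤    : ∀ {x y} z → x ≤ y → x + z ≤ y + z
    *-nonNeg     : ∀ {x y} → 0# ≤ x → 0# ≤ y → 0# ≤ x * y
    0≉1          : ¬ 0# ≈ 1#
    -- Total for convenience; its value at 0# is unspecified.
    _⁻¹          : ℝ → ℝ
    ⁻¹-cong      : ∀ {x y} → x ≈ y → x ⁻¹ ≈ y ⁻¹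
    *-inverseʳ   : ∀ {x} → ¬ x ≈ 0# → x * x ⁻¹ ≈ 1#

  UpperBound : ∀ {ℓ} → Pred ℝ ℓ → Pred ℝ ℓ
  UpperBound A u = ∀ {x} → x ∈ A → x ≤ u

  IsLub : ∀ {ℓ} → Pred ℝ ℓ → Pred ℝ ℓ
  IsLub A s = UpperBound A s × (∀ {u} → UpperBound A u → s ≤ u)

  field
    lub : ∀ {ℓ} (A : Pred ℝ ℓ) → ∃ A → ∃ (UpperBound A) → ∃ (IsLub A)

  open IsTotalOrder isTotalOrder public
    using (module Eq; antisym; total; ≤-respˡ-≈; ≤-respʳ-≈)
    renaming (refl to ≤-refl; reflexive to ≤-reflexive; trans to ≤-trans)

  open NonStrictToStrict _≈_ _≤_ public using (_<_)

  infixl 7 _/_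
  _/_ : ℝ → ℝ → ℝ
  x / y = x * y ⁻¹

  +-nonNeg : ∀ {x y} → 0# ≤ x → 0# ≤ y → 0# ≤ x + y
  +-nonNeg {x} {y} 0≤x 0≤y =
    ≤-trans 0≤y (≤-respˡ-≈ (+-identityˡ y) (+-monoˡ-≤ y 0≤x))

  x≤y⇒0≤y-x : ∀ {x y} → x ≤ y → 0# ≤ y - x
  x≤y⇒0≤y-x {x} x≤y = ≤-respˡ-≈ (-‿inverseʳ x) (+-monoˡ-≤ (- x) x≤y)

-- Excluded middle is used for the extended suprema and infima to be total
-- functions.
module Plane (em : ∀ {ℓ} → ExcludedMiddle ℓ) (R : Reals) where

  open Reals R public

  ----------------------------------------------------------------------
  -- [0,∞]

  data ℝ≥0∞ : Set where
    fin : (r : ℝ) → 0# ≤ r → ℝ≥0∞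
    ∞   : ℝ≥0∞

  0∞ : ℝ≥0∞
  0∞ = fin 0# ≤-refl

  infix  4 _≼_
  infixl 6 _⊕_

  data _≼_ : Rel ℝ≥0∞ 0ℓ where
    fin≼fin : ∀ {r s 0≤r 0≤s} → r ≤ s → fin r 0≤r ≼ fin s 0≤s
    ≼∞      : ∀ {v} → v ≼ ∞

  _⊕_ : ℝ≥0∞ → ℝ≥0∞ → ℝ≥0∞
  fin r 0≤r ⊕ fin s 0≤s = fin (r + s) (+-nonNeg 0≤r 0≤s)
  fin _ _   ⊕ ∞         = ∞
  ∞         ⊕ _         = ∞

  module _ {ℓ} {I : Set ℓ} (f : I → ℝ≥0∞) where

    -- Including 0# makes the supremum of the empty family 0.
    FiniteValue : Pred ℝ ℓ
    FiniteValue r = r ≈ 0# ⊎ (∃[ i ] Σ[ 0≤r ∈ 0# ≤ r ] f i ≡ fin r 0≤r)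

    FiniteBound : Set ℓ
    FiniteBound = ∃[ u ] Σ[ 0≤u ∈ 0# ≤ u ] (∀ i → f i ≼ fin u 0≤u)

    finiteBound⇒upperBound : FiniteBound → ∃ (UpperBound FiniteValue)
    finiteBound⇒upperBound (u , 0≤u , f≼u) = u , bound
      where
      bound : UpperBound FiniteValue u
      bound (inj₁ r≈0)            = ≤-trans (≤-reflexive r≈0) 0≤u
      bound (inj₂ (i , 0≤r , eq)) with subst (_≼ fin u 0≤u) eq (f≼u i)
      ... | fin≼fin r≤u = r≤u

    finiteLub : FiniteBound → ∃ (IsLub FiniteValue)
    finiteLub b = lub FiniteValue (0# , inj₁ Eq.refl) (finiteBound⇒upperBound b)

    ⨆-dec : Dec FiniteBound → ℝ≥0∞
    ⨆-dec (yes b) = fin (proj₁ (finiteLub b))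
                        (proj₁ (proj₂ (finiteLub b)) (inj₁ Eq.refl))
    ⨆-dec (no _)  = ∞

    ⨆ : ℝ≥0∞
    ⨆ = ⨆-dec em

    ⨆-upper : ∀ i → f i ≼ ⨆
    ⨆-upper i with em {P = FiniteBound}
    ... | no _ = ≼∞
    ... | yes b@(u , 0≤u , f≼u) with f i in eq | f≼u i
    ...   | fin r 0≤r | fin≼fin _ = fin≼fin (proj₁ (proj₂ (finiteLub b)) (inj₂ (i , 0≤r , eq)))

    ⨆-least : ∀ {v} → (∀ i → f i ≼ v) → ⨆ ≼ v
    ⨆-least {∞}         _   = ≼∞
    ⨆-least {fin u 0≤u} f≼v with em {P = FiniteBound}
    ... | no ¬b = ⊥-elim (¬b (u , 0≤u , f≼v))
    ... | yes b = fin≼fin (proj₂ (proj₂ (finiteLub b))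
                    (proj₂ (finiteBound⇒upperBound (u , 0≤u , f≼v))))

  LowerBound : ∀ {ℓ} {I : Set ℓ} → (I → ℝ≥0∞) → Pred ℝ≥0∞ ℓ
  LowerBound f v = ∀ i → v ≼ f i

  module _ {ℓ} {I : Set ℓ} (f : I → ℝ≥0∞) where

    ⨅ : ℝ≥0∞
    ⨅ = ⨆ {I = ∃ (LowerBound f)} proj₁

    ⨅-lower : ∀ i → ⨅ ≼ f i
    ⨅-lower i = ⨆-least proj₁ (λ (_ , v≼f) → v≼f i)

    ⨅-greatest : ∀ {v} → (∀ i → v ≼ f i) → v ≼ ⨅
    ⨅-greatest v≼f = ⨆-upper proj₁ (_ , v≼f)

  partialSum : (ℕ → ℝ≥0∞) → ℕ → ℝ≥0∞
  partialSum a zero    = 0∞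
  partialSum a (suc k) = partialSum a k ⊕ a k

  ∑ : (ℕ → ℝ≥0∞) → ℝ≥0∞
  ∑ a = ⨆ (partialSum a)

  ----------------------------------------------------------------------
  -- Subsets of the plane

  -- Predicates are not required to respect _≈_.  Open sets do so
  -- automatically; for any other P, an open set contains P exactly when it
  -- contains the closure of P under _≈_.
  ℝ² : Set
  ℝ² = ℝ × ℝ

  -- Squared Euclidean distance, to avoid square roots; used for ε > 0 only.
  Ball : ℝ² → ℝ → Pred ℝ² 0ℓ
  Ball (x , y) ε (x′ , y′) =
    (x′ - x) * (x′ - x) + (y′ - y) * (y′ - y) < ε * ε

  IsOpen : Pred ℝ² 0ℓ → Set
  IsOpen S = ∀ {p} → p ∈ S → ∃[ ε ] 0# < ε × Ball p ε ⊆ S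

  Square : ℝ → Pred ℝ² 0ℓ
  Square n (x , y) = (0# ≤ x × x ≤ n) × (0# ≤ y × y ≤ n)

  ----------------------------------------------------------------------
  -- Lebesgue measure

  record Rectangle : Set where
    field
      {left right bottom top} : ℝ
      left≤right : left ≤ right
      bottom≤top : bottom ≤ top

    points : Pred ℝ² 0ℓ
    points (x , y) = (left ≤ x × x ≤ right) × (bottom ≤ y × y ≤ top)

    area : ℝ≥0∞
    area = fin ((right - left) * (top - bottom))
               (*-nonNeg (x≤y⇒0≤y-x left≤right) (x≤y⇒0≤y-x bottom≤top))

  open Rectangle public using (points; area)

  Cover : Pred ℝ² 0ℓ → Set
  Cover E = Σ[ B ∈ (ℕ → Rectangle) ] (∀ {p} → p ∈ E → ∃[ i ] p ∈ points (B i))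

  -- Lebesgue outer measure, whose restriction to measurable sets is Lebesgue
  -- measure.  It is only applied to open sets, which are measurable.
  μ₂ : Pred ℝ² 0ℓ → ℝ≥0∞
  μ₂ E = ⨅ {I = Cover E} (λ (B , _) → ∑ (λ i → area (B i)))

  ----------------------------------------------------------------------
  -- Containment

  X-coords : Pred ℝ² 0ℓ → Pred ℝ 0ℓ
  X-coords P x = ∃[ y ] P (x , y)

  Y-coords : Pred ℝ² 0ℓ → Pred ℝ 0ℓ
  Y-coords P y = ∃[ x ] P (x , y)

  -- A subset as a setoid: membership proofs are irrelevant to equality, so a
  -- Func between two of these is a function of the underlying reals.
  Sub : Pred ℝ 0ℓ → Setoid 0ℓ 0ℓ
  Sub A = On.setoid setoid (proj₁ {B = A})

  module _ {A B : Pred ℝ 0ℓ} (f : Func (Sub A) (Sub B)) where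
    open Func f

    value : ∀ x → x ∈ A → ℝ
    value x x∈A = proj₁ (to (x , x∈A))

    Expansive : Set
    Expansive = ∀ {x₀ x₁} (x₀∈A : x₀ ∈ A) (x₁∈A : x₁ ∈ A) → x₁ < x₀ →
      1# ≤ (value x₀ x₀∈A - value x₁ x₁∈A) / (x₀ - x₁)

  record _Contains_ (S P : Pred ℝ² 0ℓ) : Set where
    field
      fX          : Func (Sub (X-coords P)) (Sub (X-coords S))
      fY          : Func (Sub (Y-coords P)) (Sub (Y-coords S))
      fX-expands  : Expansive fX
      fY-expands  : Expansive fY
      maps-into-S : ∀ {x y} (xy∈P : (x , y) ∈ P) →
        (value fX x (y , xy∈P) , value fY y (x , xy∈P)) ∈ S

  _IsFreeOf_ : Pred ℝ² 0ℓ → Pred ℝ² 0ℓ → Set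
  S IsFreeOf P = ¬ S Contains P

  -- When P is empty no S is P-free, and the supremum over the empty family,
  -- taken in [0,∞], is 0.
  opx : ℝ → Pred ℝ² 0ℓ → ℝ≥0∞
  opx n P = ⨆ {I = Σ[ S ∈ Pred ℝ² 0ℓ ] IsOpen S × S IsFreeOf P × S ⊆ Square n}
              (λ (S , _) → μ₂ S)

{-# OPTIONS --safe #-}
-- Given P-free open sets S ⊆ [0,m]² and T ⊆ [0,n]², place copies of them in
-- [0,m+n]² either along the diagonal or along the antidiagonal; both unions
-- have outer measure at least μ₂ S ⊕ μ₂ T, because every covering rectangle
-- can be cut at x = m.  It remains to see that one of them is P-free.
--
-- If the diagonal union contains P, then P splits into two parts (both
-- nonempty, as S and T are P-free), one strictly below and to the left of the
-- other.  Likewise, if the antidiagonal union contains P, then P splits into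
-- two nonempty parts, one strictly above and to the left of the other.  Two
-- points cannot be separated by both splittings, and a set of points cannot
-- carry two nontrivial bipartitions such that no pair is separated by both.
module Submission where

open import Defs
open import Level using (0ℓ)
open import Axiom.ExcludedMiddle using (ExcludedMiddle)
open import Relation.Unary using (Pred)

import Algebra.Properties.AbelianGroup as AbelianGroupProperties
import Algebra.Properties.CommutativeSemigroup as CommutativeSemigroupProperties
import Algebra.Properties.Ring as RingProperties
open import Data.Empty using (⊥; ⊥-elim)
import Data.Nat.Base as ℕ
import Data.Nat.Properties as ℕ
open import Data.Product.Base using (Σ-syntax; ∃; ∃-syntax; _×_; _,_; proj₁; proj₂)
open import Data.Sum.Base using (_⊎_; inj₁; inj₂)
open import Function.Base using (flip; _∘_)
open import Function.Bundles using (Func)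
open import Relation.Binary.Bundles using (Poset)
open import Relation.Binary.Core using (Rel)
import Relation.Binary.Construct.NonStrictToStrict as NonStrictToStrict
open import Relation.Binary.Structures using (IsTotalOrder)
open import Relation.Nullary using (¬_; yes; no)
open import Relation.Unary using (_∈_; _⊆_; _∪_; ∅)

module _ (em : ∀ {ℓ} → ExcludedMiddle ℓ) (R : Reals) where

  open Plane em R
  open AbelianGroupProperties +-abelianGroup
    using (xyx⁻¹≈y; //-rightDividesˡ; //-rightDividesʳ; ⁻¹-involutive)
    renaming (⁻¹-anti-homo‿- to -‿anti-homo-)
  open CommutativeSemigroupProperties +-commutativeSemigroup using (interchange)
  open RingProperties ring using (-1*x≈-x)
  open IsTotalOrder isTotalOrder using (isPartialOrder)

  private
    ≤-poset : Poset 0ℓ 0ℓ 0ℓ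
    ≤-poset = record { isPartialOrder = isPartialOrder }

    module Strict = NonStrictToStrict _≈_ _≤_

  open import Relation.Binary.Reasoning.PartialOrder ≤-poset

  -- Ordered field arithmetic

  <⇒≱ : ∀ {x y} → x < y → ¬ y ≤ x
  <⇒≱ = Strict.<⇒≱ antisym

  <-asym : ∀ {x y} → x < y → ¬ y < x
  <-asym = Strict.<-asym antisym

  x-y+y≈x : ∀ x y → x - y + y ≈ x
  x-y+y≈x x y = //-rightDividesˡ y x

  x+y-y≈x : ∀ x y → x + y - y ≈ x
  x+y-y≈x x y = //-rightDividesʳ y x

  telescope : ∀ x y z → (x - y) + (y - z) ≈ x - z
  telescope x y z = begin-equality
    (x - y) + (y - z)  ≈⟨ +-assoc (x - y) y (- z) ⟨
    (x - y) + y - z    ≈⟨ +-congʳ (x-y+y≈x x y) ⟩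
    x - z              ∎

  [x-z]-[y-z]≈x-y : ∀ x y z → (x - z) - (y - z) ≈ x - y
  [x-z]-[y-z]≈x-y x y z = begin-equality
    (x - z) - (y - z)  ≈⟨ +-congˡ (-‿anti-homo- y z) ⟩
    (x - z) + (z - y)  ≈⟨ telescope x z y ⟩
    x - y              ∎

  +-monoʳ-≤ : ∀ {x y} z → x ≤ y → z + x ≤ z + y
  +-monoʳ-≤ {x} {y} z x≤y = begin
    z + x  ≈⟨ +-comm z x ⟩
    x + z  ≤⟨ +-monoˡ-≤ z x≤y ⟩
    y + z  ≈⟨ +-comm y z ⟩
    z + y  ∎

  +-mono-≤ : ∀ {x y z w} → x ≤ y → z ≤ w → x + z ≤ y + w
  +-mono-≤ {y = y} {z} x≤y z≤w = ≤-trans (+-monoˡ-≤ z x≤y) (+-monoʳ-≤ y z≤w)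

  x≤x+y : ∀ {x y} → 0# ≤ y → x ≤ x + y
  x≤x+y {x} {y} 0≤y = begin
    x       ≈⟨ +-identityʳ x ⟨
    x + 0#  ≤⟨ +-monoʳ-≤ x 0≤y ⟩
    x + y   ∎

  x<x+y : ∀ {x y} → 0# < y → x < x + y
  x<x+y {x} {y} (0≤y , 0≉y) = x≤x+y 0≤y , λ x≈x+y → 0≉y (begin-equality
    0#         ≈⟨ -‿inverseʳ x ⟨
    x - x      ≈⟨ +-congʳ x≈x+y ⟩
    x + y - x  ≈⟨ xyx⁻¹≈y x y ⟩
    y          ∎)

  0≤y-x⇒x≤y : ∀ {x y} → 0# ≤ y - x → x ≤ y
  0≤y-x⇒x≤y {x} {y} 0≤y-x = begin
    x            ≤⟨ x≤x+y 0≤y-x ⟩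
    x + (y - x)  ≈⟨ +-comm x (y - x) ⟩
    y - x + x    ≈⟨ x-y+y≈x y x ⟩
    y            ∎

  x-z≤y⇒x≤y+z : ∀ {x y z} → x - z ≤ y → x ≤ y + z
  x-z≤y⇒x≤y+z {x} {y} {z} x-z≤y = begin
    x          ≈⟨ x-y+y≈x x z ⟨
    x - z + z  ≤⟨ +-monoˡ-≤ z x-z≤y ⟩
    y + z      ∎

  -- The hypotheses are the coordinate bounds exactly as they come from a set translated by `0#` and
  -- a set translated by `k`, hence the uncancelled `x - 0#`.
  x-0<k∧0≤y-k⇒x<y : ∀ {x y k} → x - 0# < k → 0# ≤ y - k → x < y
  x-0<k∧0≤y-k⇒x<y {x} {y} {k} x-0<k 0≤y-k = begin-strict
    x            ≈⟨ x-y+y≈x x 0# ⟨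
    x - 0# + 0#  ≈⟨ +-identityʳ (x - 0#) ⟩
    x - 0#       <⟨ x-0<k ⟩
    k            ≤⟨ 0≤y-x⇒x≤y 0≤y-k ⟩
    y            ∎

  x+y≤z⇒y≤z-x : ∀ {x y z} → x + y ≤ z → y ≤ z - x
  x+y≤z⇒y≤z-x {x} {y} {z} x+y≤z = begin
    y          ≈⟨ xyx⁻¹≈y x y ⟨
    x + y - x  ≤⟨ +-monoˡ-≤ (- x) x+y≤z ⟩
    z - x      ∎

  y≤z-x⇒x+y≤z : ∀ {x y z} → y ≤ z - x → x + y ≤ z
  y≤z-x⇒x+y≤z {x} {y} {z} y≤z-x = begin
    x + y        ≤⟨ +-monoʳ-≤ x y≤z-x ⟩
    x + (z - x)  ≈⟨ +-comm x (z - x) ⟩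
    z - x + x    ≈⟨ x-y+y≈x z x ⟩
    z            ∎

  0≤1 : 0# ≤ 1#
  0≤1 with total 0# 1#
  ... | inj₁ 0≤1 = 0≤1
  -- Then -1 is nonnegative, and so is its square, which is 1.
  ... | inj₂ 1≤0 = begin
    0#             ≤⟨ *-nonNeg 0≤-1 0≤-1 ⟩
    - 1# * (- 1#)  ≈⟨ -1*x≈-x (- 1#) ⟩
    - (- 1#)       ≈⟨ ⁻¹-involutive 1# ⟩
    1#             ∎
    where
    0≤-1 : 0# ≤ - 1#
    0≤-1 = ≤-respʳ-≈ (+-identityˡ (- 1#)) (x≤y⇒0≤y-x 1≤0)

  *-inverse-cancel : ∀ x {y} → ¬ y ≈ 0# → x * y ⁻¹ * y ≈ x
  *-inverse-cancel x {y} y≉0 = begin-equality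
    x * y ⁻¹ * y    ≈⟨ *-assoc x (y ⁻¹) y ⟩
    x * (y ⁻¹ * y)  ≈⟨ *-congˡ (*-comm (y ⁻¹) y) ⟩
    x * (y * y ⁻¹)  ≈⟨ *-congˡ (*-inverseʳ y≉0) ⟩
    x * 1#          ≈⟨ *-identityʳ x ⟩
    x               ∎

  +-pos : ∀ {x y} → 0# < x → 0# < y → 0# < x + y
  +-pos {x} {y} 0<x 0<y = begin-strict
    0#     <⟨ 0<x ⟩
    x      <⟨ x<x+y 0<y ⟩
    x + y  ∎

  *-pos : ∀ {x y} → 0# < x → 0# < y → 0# < x * y
  *-pos {x} {y} (0≤x , 0≉x) (0≤y , 0≉y) = *-nonNeg 0≤x 0≤y , λ 0≈xy → 0≉y (begin-equality
    0#              ≈⟨ zeroˡ (x ⁻¹) ⟨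
    0# * x ⁻¹       ≈⟨ *-congʳ 0≈xy ⟩
    x * y * x ⁻¹    ≈⟨ *-congʳ (*-comm x y) ⟩
    y * x * x ⁻¹    ≈⟨ *-assoc y x (x ⁻¹) ⟩
    y * (x * x ⁻¹)  ≈⟨ *-congˡ (*-inverseʳ (0≉x ∘ Eq.sym)) ⟩
    y * 1#          ≈⟨ *-identityʳ y ⟩
    y               ∎)

  halve : ∀ {x} → 0# < x → ∃[ d ] 0# < d × d + d ≈ x
  halve {x} 0<x = d , (0≤d , 0≉d) , d+d≈x
    where
    2# d : ℝ
    2# = 1# + 1#
    d = x / 2#

    d+d≈x : d + d ≈ x
    d+d≈x = begin-equality
      d + d            ≈⟨ +-cong (*-identityʳ d) (*-identityʳ d) ⟨
      d * 1# + d * 1#  ≈⟨ distribˡ d 1# 1# ⟨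
      d * 2#           ≈⟨ *-inverse-cancel x (proj₂ (+-pos (0≤1 , 0≉1) (0≤1 , 0≉1)) ∘ Eq.sym) ⟩
      x                ∎

    0≤d : 0# ≤ d
    0≤d with total 0# d
    ... | inj₁ 0≤d = 0≤d
    ... | inj₂ d≤0 = ⊥-elim (<⇒≱ 0<x (begin
      x        ≈⟨ d+d≈x ⟨
      d + d    ≤⟨ +-mono-≤ d≤0 d≤0 ⟩
      0# + 0#  ≈⟨ +-identityˡ 0# ⟩
      0#       ∎))

    0≉d : ¬ 0# ≈ d
    0≉d 0≈d = proj₂ 0<x (begin-equality
      0#       ≈⟨ +-identityˡ 0# ⟨
      0# + 0#  ≈⟨ +-cong 0≈d 0≈d ⟩
      d + d    ≈⟨ d+d≈x ⟩
      x        ∎)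

  -- Extended nonnegative reals

  ≼-refl : ∀ {a} → a ≼ a
  ≼-refl {fin _ _} = fin≼fin ≤-refl
  ≼-refl {∞}       = ≼∞

  ≼-trans : ∀ {a b c} → a ≼ b → b ≼ c → a ≼ c
  ≼-trans (fin≼fin r≤s) (fin≼fin s≤t) = fin≼fin (≤-trans r≤s s≤t)
  ≼-trans _             ≼∞            = ≼∞

  ⊕-mono : ∀ {a b c d} → a ≼ b → c ≼ d → a ⊕ c ≼ b ⊕ d
  ⊕-mono (fin≼fin r≤s) (fin≼fin t≤u) = fin≼fin (+-mono-≤ r≤s t≤u)
  ⊕-mono (fin≼fin _)   ≼∞            = ≼∞
  ⊕-mono ≼∞            _             = ≼∞

  ⊕-comm : ∀ a b → a ⊕ b ≼ b ⊕ a
  ⊕-comm (fin r _) (fin s _) = fin≼fin (≤-reflexive (+-comm r s))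
  ⊕-comm (fin _ _) ∞         = ≼∞
  ⊕-comm ∞         (fin _ _) = ≼∞
  ⊕-comm ∞         ∞         = ≼∞

  ⊕-interchange : ∀ a b c d → (a ⊕ b) ⊕ (c ⊕ d) ≼ (a ⊕ c) ⊕ (b ⊕ d)
  ⊕-interchange (fin r _) (fin s _) (fin t _) (fin u _) = fin≼fin (≤-reflexive (interchange r s t u))
  ⊕-interchange (fin _ _) (fin _ _) (fin _ _) ∞         = ≼∞
  ⊕-interchange (fin _ _) (fin _ _) ∞         _         = ≼∞
  ⊕-interchange (fin _ _) ∞         (fin _ _) _         = ≼∞
  ⊕-interchange (fin _ _) ∞         ∞         _         = ≼∞
  ⊕-interchange ∞         _         _         _         = ≼∞

  a≼a⊕b : ∀ a b → a ≼ a ⊕ b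
  a≼a⊕b (fin _ _) (fin _ 0≤s) = fin≼fin (x≤x+y 0≤s)
  a≼a⊕b (fin _ _) ∞           = ≼∞
  a≼a⊕b ∞         _           = ≼∞

  -- If `a` is finite with value `r` and `v` is finite with value `u`, then `u - r` bounds `f`, and
  -- adding `r` back gives the claim. The index `i₀` excludes the empty family, whose supremum is 0:
  -- it yields `r ≤ u`, so that `u - r` is again an element of [0,∞].
  ⊕-⨆-least : ∀ {ℓ} {I : Set ℓ} (f : I → ℝ≥0∞) a {v} →
    I → (∀ i → a ⊕ f i ≼ v) → a ⊕ ⨆ f ≼ v
  ⊕-⨆-least f ∞           i₀ a⊕f≼v = a⊕f≼v i₀
  ⊕-⨆-least f (fin _ _)   {∞}         i₀ a⊕f≼v = ≼∞
  ⊕-⨆-least f (fin r 0≤r) {fin u 0≤u} i₀ a⊕f≼v = fin⊕≼ (⨆ f) (⨆-least f f≼u-r)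
    where
    r≤u : r ≤ u
    r≤u with fin≼fin r≤u ← ≼-trans (a≼a⊕b (fin r 0≤r) (f i₀)) (a⊕f≼v i₀) = r≤u

    ≼u-r : ∀ b → fin r 0≤r ⊕ b ≼ fin u 0≤u → b ≼ fin (u - r) (x≤y⇒0≤y-x r≤u)
    ≼u-r (fin _ _) (fin≼fin r+s≤u) = fin≼fin (x+y≤z⇒y≤z-x r+s≤u)

    f≼u-r : ∀ i → f i ≼ fin (u - r) (x≤y⇒0≤y-x r≤u)
    f≼u-r i = ≼u-r (f i) (a⊕f≼v i)

    fin⊕≼ : ∀ b → b ≼ fin (u - r) (x≤y⇒0≤y-x r≤u) → fin r 0≤r ⊕ b ≼ fin u 0≤u
    fin⊕≼ (fin _ _) (fin≼fin s≤u-r) = fin≼fin (y≤z-x⇒x+y≤z s≤u-r)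

  ⨆⊕⨆-least : ∀ {ℓ ℓ′} {I : Set ℓ} {J : Set ℓ′} (f : I → ℝ≥0∞) (g : J → ℝ≥0∞) {v} →
    I → J → (∀ i j → f i ⊕ g j ≼ v) → ⨆ f ⊕ ⨆ g ≼ v
  ⨆⊕⨆-least f g i₀ j₀ f⊕g≼v = ≼-trans (⊕-comm (⨆ f) (⨆ g))
    (⊕-⨆-least f (⨆ g) i₀ λ i → ≼-trans (⊕-comm (⨆ g) (f i))
      (⊕-⨆-least g (f i) j₀ (f⊕g≼v i)))

  partialSum-mono : ∀ {a b} → (∀ i → a i ≼ b i) → ∀ k → partialSum a k ≼ partialSum b k
  partialSum-mono a≼b ℕ.zero    = ≼-refl
  partialSum-mono a≼b (ℕ.suc k) = ⊕-mono (partialSum-mono a≼b k) (a≼b k)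

  partialSum-increasing : ∀ a {j k} → j ℕ.≤′ k → partialSum a j ≼ partialSum a k
  partialSum-increasing a ℕ.≤′-refl                  = ≼-refl
  partialSum-increasing a (ℕ.≤′-step {n = k} j≤k) =
    ≼-trans (partialSum-increasing a j≤k) (a≼a⊕b (partialSum a k) (a k))

  partialSum-⊕ : ∀ {a b c} → (∀ i → a i ⊕ b i ≼ c i) →
    ∀ k → partialSum a k ⊕ partialSum b k ≼ partialSum c k
  partialSum-⊕ a⊕b≼c ℕ.zero = fin≼fin (≤-reflexive (+-identityˡ 0#))
  partialSum-⊕ {a} {b} a⊕b≼c (ℕ.suc k) =
    ≼-trans (⊕-interchange (partialSum a k) (a k) (partialSum b k) (b k))
            (⊕-mono (partialSum-⊕ a⊕b≼c k) (a⊕b≼c k))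

  ∑-mono : ∀ {a b} → (∀ i → a i ≼ b i) → ∑ a ≼ ∑ b
  ∑-mono {a} {b} a≼b = ⨆-least (partialSum a) λ k →
    ≼-trans (partialSum-mono a≼b k) (⨆-upper (partialSum b) k)

  -- The two suprema run over independent indices `j` and `k`. Partial sums increase, so both can be
  -- moved to the common index `j ⊔ k`, where the comparison is termwise.
  ∑-⊕ : ∀ {a b c} → (∀ i → a i ⊕ b i ≼ c i) → ∑ a ⊕ ∑ b ≼ ∑ c
  ∑-⊕ {a} {b} {c} a⊕b≼c = ⨆⊕⨆-least (partialSum a) (partialSum b) 0 0 λ j k →
    ≼-trans (⊕-mono (partialSum-increasing a (ℕ.≤⇒≤′ (ℕ.m≤m⊔n j k)))
                    (partialSum-increasing b (ℕ.≤⇒≤′ (ℕ.m≤n⊔m j k))))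
      (≼-trans (partialSum-⊕ a⊕b≼c (j ℕ.⊔ k)) (⨆-upper (partialSum c) (j ℕ.⊔ k)))

  -- Open sets and translations

  -- This is S + (a, b). Membership unfolds to membership of the moved-back point in `S`, so bounds
  -- known for `S` apply to it directly.
  translate : ℝ → ℝ → Pred ℝ² 0ℓ → Pred ℝ² 0ℓ
  translate a b S (x , y) = S (x - a , y - b)

  translate-open : ∀ {S} a b → IsOpen S → IsOpen (translate a b S)
  translate-open a b S-open {x , y} p∈S with ε , 0<ε , ball⊆S ← S-open p∈S =
    ε , 0<ε , λ { {x′ , y′} near → ball⊆S (begin-strict
      (x′ - a - (x - a)) * (x′ - a - (x - a)) + (y′ - b - (y - b)) * (y′ - b - (y - b))
        ≈⟨ +-cong (*-cong ([x-z]-[y-z]≈x-y x′ x a) ([x-z]-[y-z]≈x-y x′ x a))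
                  (*-cong ([x-z]-[y-z]≈x-y y′ y b) ([x-z]-[y-z]≈x-y y′ y b)) ⟩
      (x′ - x) * (x′ - x) + (y′ - y) * (y′ - y)
        <⟨ near ⟩
      ε * ε ∎) }

  translate-⊆-Square : ∀ {S a b k l} → 0# ≤ a → k + a ≤ l → 0# ≤ b → k + b ≤ l →
    S ⊆ Square k → translate a b S ⊆ Square l
  translate-⊆-Square {a = a} {b} 0≤a k+a≤l 0≤b k+b≤l S⊆□ {x , y} p∈S
    with (0≤x-a , x-a≤k) , (0≤y-b , y-b≤k) ← S⊆□ p∈S =
      (≤-trans 0≤a (0≤y-x⇒x≤y 0≤x-a) , ≤-trans (x-z≤y⇒x≤y+z x-a≤k) k+a≤l) ,
      (≤-trans 0≤b (0≤y-x⇒x≤y 0≤y-b) , ≤-trans (x-z≤y⇒x≤y+z y-b≤k) k+b≤l)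

  ∪-open : ∀ {S T} → IsOpen S → IsOpen T → IsOpen (S ∪ T)
  ∪-open S-open T-open (inj₁ p∈S) with ε , 0<ε , ball⊆S ← S-open p∈S =
    ε , 0<ε , λ near → inj₁ (ball⊆S near)
  ∪-open S-open T-open (inj₂ p∈T) with ε , 0<ε , ball⊆T ← T-open p∈T =
    ε , 0<ε , λ near → inj₂ (ball⊆T near)

  -- Equal points are at distance zero, hence inside every ball. Arbitrary predicates need not
  -- respect `≈`.
  open-resp-≈ : ∀ {S} → IsOpen S → ∀ {x y x′ y′} → x ≈ x′ → y ≈ y′ →
    (x , y) ∈ S → (x′ , y′) ∈ S
  open-resp-≈ S-open {x} {y} {x′} {y′} x≈x′ y≈y′ p∈S with ε , 0<ε , ball⊆S ← S-open p∈S =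
    ball⊆S (begin-strict
      (x′ - x) * (x′ - x) + (y′ - y) * (y′ - y)
        ≈⟨ +-cong (*-congʳ (-≈0 x≈x′)) (*-congʳ (-≈0 y≈y′)) ⟩
      0# * (x′ - x) + 0# * (y′ - y)
        ≈⟨ +-cong (zeroˡ (x′ - x)) (zeroˡ (y′ - y)) ⟩
      0# + 0#  ≈⟨ +-identityˡ 0# ⟩
      0#       <⟨ *-pos 0<ε 0<ε ⟩
      ε * ε    ∎)
    where
    -≈0 : ∀ {u v} → u ≈ v → v - u ≈ 0#
    -≈0 {u} {v} u≈v = Eq.trans (+-congʳ (Eq.sym u≈v)) (-‿inverseʳ u)

  -- Take half the radius as `δ`: the squared distance is then 2δ², less than 4δ² = ε².
  open-northeast : ∀ {S} → IsOpen S → ∀ {x y} → (x , y) ∈ S →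
    ∃[ δ ] 0# < δ × (x + δ , y + δ) ∈ S
  open-northeast S-open {x} {y} p∈S with ε , 0<ε , ball⊆S ← S-open p∈S
    with δ , 0<δ , δ+δ≈ε ← halve 0<ε = δ , 0<δ , ball⊆S (begin-strict
      (x + δ - x) * (x + δ - x) + (y + δ - y) * (y + δ - y)
        ≈⟨ +-cong (*-cong (xyx⁻¹≈y x δ) (xyx⁻¹≈y x δ)) (*-cong (xyx⁻¹≈y y δ) (xyx⁻¹≈y y δ)) ⟩
      δ * δ + δ * δ
        <⟨ x<x+y (+-pos (*-pos 0<δ 0<δ) (*-pos 0<δ 0<δ)) ⟩
      (δ * δ + δ * δ) + (δ * δ + δ * δ)
        ≈⟨ +-cong (distribˡ δ δ δ) (distribˡ δ δ δ) ⟨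
      δ * (δ + δ) + δ * (δ + δ)
        ≈⟨ distribʳ (δ + δ) δ δ ⟨
      (δ + δ) * (δ + δ)
        ≈⟨ *-cong δ+δ≈ε δ+δ≈ε ⟩
      ε * ε ∎)

  -- A point on the top or right edge would have a northeast neighbour in `S` outside the square.
  -- The strictness makes the two placed sets strictly separated even though their closed squares
  -- touch.
  open-⊆-Square⇒< : ∀ {S k} → IsOpen S → S ⊆ Square k →
    ∀ {x y} → (x , y) ∈ S → x < k × y < k
  open-⊆-Square⇒< {k = k} S-open S⊆□ {x} {y} p∈S
    with δ , 0<δ , q∈S ← open-northeast S-open p∈S
    with (_ , x+δ≤k) , (_ , y+δ≤k) ← S⊆□ q∈S =
      (begin-strict x <⟨ x<x+y 0<δ ⟩ x + δ ≤⟨ x+δ≤k ⟩ k ∎) ,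
      (begin-strict y <⟨ x<x+y 0<δ ⟩ y + δ ≤⟨ y+δ≤k ⟩ k ∎)

  -- Outer measure

  -- The motion is by (-a, -b), which undoes `translate a b`.
  shift : ℝ → ℝ → Rectangle → Rectangle
  shift a b B = record
    { left≤right = +-monoˡ-≤ (- a) (Rectangle.left≤right B)
    ; bottom≤top = +-monoˡ-≤ (- b) (Rectangle.bottom≤top B)
    }

  area-shift : ∀ a b B → area (shift a b B) ≼ area B
  area-shift a b B = fin≼fin (≤-reflexive
    (*-cong ([x-z]-[y-z]≈x-y right left a) ([x-z]-[y-z]≈x-y top bottom b)))
    where open Rectangle B

  -- Every cover of the translate moves back to a cover of `S` with the same areas, so the infimum
  -- for `S` is at most the one for the translate.
  μ₂-translate : ∀ {S} a b → IsOpen S → μ₂ S ≼ μ₂ (translate a b S)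
  μ₂-translate {S} a b S-open = ⨅-greatest _ λ C →
    ≼-trans (⨅-lower _ (shift-cover C)) (∑-mono λ i → area-shift a b (proj₁ C i))
    where
    ≤-shift : ∀ {l x c} → l ≤ x + c → l - c ≤ x
    ≤-shift {l} {x} {c} l≤x+c = ≤-respʳ-≈ (x+y-y≈x x c) (+-monoˡ-≤ (- c) l≤x+c)

    shift-≤ : ∀ {r x c} → x + c ≤ r → x ≤ r - c
    shift-≤ {r} {x} {c} x+c≤r = ≤-respˡ-≈ (x+y-y≈x x c) (+-monoˡ-≤ (- c) x+c≤r)

    shift-cover : Cover (translate a b S) → Cover S
    shift-cover (B , covers) = (λ i → shift a b (B i)) , λ { {x , y} p∈S →
      let i , (l≤x , x≤r) , (b≤y , y≤t) =
            covers {x + a , y + b}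
              -- Membership of `(x + a , y + b)` in the translate unfolds to a statement about
              -- `x + a - a` and `y + b - b`, which agree with `x` and `y` only up to `≈`.
              (open-resp-≈ S-open (Eq.sym (x+y-y≈x x a)) (Eq.sym (x+y-y≈x y b)) p∈S)
      in i , (≤-shift l≤x , shift-≤ x≤r) , (≤-shift b≤y , shift-≤ y≤t) }

  -- The witness is the point of [l, r] nearest to `c`. An interval lying on one side of `c` is thus
  -- still cut in two, one piece being degenerate, and the last two clauses say that no point ends
  -- up in the wrong piece.
  clamp : ∀ c {l r} → l ≤ r → ∃[ d ] (l ≤ d × d ≤ r) ×
    (∀ {x} → x ≤ r → x ≤ c → x ≤ d) × (∀ {x} → l ≤ x → c ≤ x → d ≤ x)
  clamp c {l} {r} l≤r with total r c | total c l
  ... | inj₁ r≤c | _        = r , (l≤r , ≤-refl) , (λ x≤r _ → x≤r) , (λ _ c≤x → ≤-trans r≤c c≤x)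
  ... | inj₂ c≤r | inj₁ c≤l = l , (≤-refl , l≤r) , (λ _ x≤c → ≤-trans x≤c c≤l) , (λ l≤x _ → l≤x)
  ... | inj₂ c≤r | inj₂ l≤c = c , (l≤c , c≤r) , (λ _ x≤c → x≤c) , (λ _ c≤x → c≤x)

  record Cut (c : ℝ) (B : Rectangle) : Set where
    field
      leftPart rightPart : Rectangle
      area-⊕      : area leftPart ⊕ area rightPart ≼ area B
      ∈-leftPart  : ∀ {p} → p ∈ points B → proj₁ p ≤ c → p ∈ points leftPart
      ∈-rightPart : ∀ {p} → p ∈ points B → c ≤ proj₁ p → p ∈ points rightPart

  cut : ∀ c B → Cut c B
  cut c B with d , (l≤d , d≤r) , below , above ← clamp c (Rectangle.left≤right B) = record
    { leftPart    = record { left≤right = l≤d ; bottom≤top = bottom≤top }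
    ; rightPart   = record { left≤right = d≤r ; bottom≤top = bottom≤top }
    ; area-⊕      = fin≼fin (begin
        (d - left) * (top - bottom) + (right - d) * (top - bottom)
          ≈⟨ distribʳ (top - bottom) (d - left) (right - d) ⟨
        (d - left + (right - d)) * (top - bottom)
          ≈⟨ *-congʳ (+-comm (d - left) (right - d)) ⟩
        (right - d + (d - left)) * (top - bottom)
          ≈⟨ *-congʳ (telescope right d left) ⟩
        (right - left) * (top - bottom) ∎)
    ; ∈-leftPart  = λ { ((l≤x , x≤r) , y∈B) x≤c → (l≤x , below x≤r x≤c) , y∈B }
    ; ∈-rightPart = λ { ((l≤x , x≤r) , y∈B) c≤x → (above l≤x c≤x , x≤r) , y∈B }
    }
    where open Rectangle B

  -- Outer measure is subadditive in general; the reverse inequality holds here because the line x =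
  -- c splits each cover of the union into a cover of `S` and a cover of `T` of no greater total
  -- area.
  μ₂-∪ : ∀ c {S T} → (∀ {p} → p ∈ S → proj₁ p ≤ c) → (∀ {p} → p ∈ T → c ≤ proj₁ p) →
    μ₂ S ⊕ μ₂ T ≼ μ₂ (S ∪ T)
  μ₂-∪ c {S} {T} S≤c c≤T = ⨅-greatest _ λ C →
    ≼-trans (⊕-mono (⨅-lower _ (left-cover C)) (⨅-lower _ (right-cover C)))
            (∑-⊕ λ i → area-⊕ (cut c (proj₁ C i)))
    where
    open Cut

    left-cover : Cover (S ∪ T) → Cover S
    left-cover (B , covers) = (λ i → leftPart (cut c (B i))) , λ p∈S →
      let i , p∈B = covers (inj₁ p∈S) in i , ∈-leftPart (cut c (B i)) p∈B (S≤c p∈S)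

    right-cover : Cover (S ∪ T) → Cover T
    right-cover (B , covers) = (λ i → rightPart (cut c (B i))) , λ p∈T →
      let i , p∈B = covers (inj₂ p∈T) in i , ∈-rightPart (cut c (B i)) p∈B (c≤T p∈T)

  -- Containment

  module _ {A B : Pred ℝ 0ℓ} (f : Func (Sub A) (Sub B)) (f-expands : Expansive f) where

    expansive⇒mono : ∀ {x₀ x₁} (x₀∈A : x₀ ∈ A) (x₁∈A : x₁ ∈ A) →
      x₁ < x₀ → value f x₁ x₁∈A ≤ value f x₀ x₀∈A
    expansive⇒mono {x₀} {x₁} x₀∈A x₁∈A (x₁≤x₀ , x₁≉x₀) = 0≤y-x⇒x≤y (begin
      0#                          ≤⟨ *-nonNeg (≤-trans 0≤1 (f-expands x₀∈A x₁∈A (x₁≤x₀ , x₁≉x₀)))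
                                              (x≤y⇒0≤y-x x₁≤x₀) ⟩
      Δf / (x₀ - x₁) * (x₀ - x₁)  ≈⟨ *-inverse-cancel Δf x₀-x₁≉0 ⟩
      Δf                          ∎)
      where
      Δf : ℝ
      Δf = value f x₀ x₀∈A - value f x₁ x₁∈A

      x₀-x₁≉0 : ¬ x₀ - x₁ ≈ 0#
      x₀-x₁≉0 x₀-x₁≈0 = x₁≉x₀ (begin-equality
        x₁            ≈⟨ +-identityˡ x₁ ⟨
        0# + x₁       ≈⟨ +-congʳ x₀-x₁≈0 ⟨
        x₀ - x₁ + x₁  ≈⟨ x-y+y≈x x₀ x₁ ⟩
        x₀            ∎)

    -- By totality of the order only two alternatives need refuting: equal arguments have equal
    -- values because `f` respects `≈`, and the opposite order contradicts monotonicity. This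
    -- carries a separation of images back to the points of `P`.
    expansive⇒reflects-< : ∀ {x₀ x₁} (x₀∈A : x₀ ∈ A) (x₁∈A : x₁ ∈ A) →
      value f x₁ x₁∈A < value f x₀ x₀∈A → x₁ < x₀
    expansive⇒reflects-< {x₀} {x₁} x₀∈A x₁∈A fx₁<fx₀ = x₁≤x₀ , x₁≉x₀
      where
      x₁≉x₀ : ¬ x₁ ≈ x₀
      x₁≉x₀ x₁≈x₀ = proj₂ fx₁<fx₀ (Func.cong f {x₁ , x₁∈A} {x₀ , x₀∈A} x₁≈x₀)

      x₁≤x₀ : x₁ ≤ x₀
      x₁≤x₀ with total x₁ x₀
      ... | inj₁ x₁≤x₀ = x₁≤x₀
      ... | inj₂ x₀≤x₁ = ⊥-elim (<⇒≱ fx₁<fx₀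
        (expansive⇒mono x₁∈A x₀∈A (x₀≤x₁ , x₁≉x₀ ∘ Eq.sym)))

  module Image {V P : Pred ℝ² 0ℓ} (C : V Contains P) where
    open _Contains_ C public

    image : ∃ P → ℝ²
    image ((x , y) , xy∈P) = value fX x (y , xy∈P) , value fY y (x , xy∈P)

    image∈ : ∀ p → image p ∈ V
    image∈ (_ , xy∈P) = maps-into-S xy∈P

    image-reflects-<ˣ : ∀ p q → proj₁ (image p) < proj₁ (image q) →
      proj₁ (proj₁ p) < proj₁ (proj₁ q)
    image-reflects-<ˣ _ _ = expansive⇒reflects-< fX fX-expands _ _

    image-reflects-<ʸ : ∀ p q → proj₂ (image p) < proj₂ (image q) →
      proj₂ (proj₁ p) < proj₂ (proj₁ q)
    image-reflects-<ʸ _ _ = expansive⇒reflects-< fY fY-expands _ _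

    -- Subtracting constants leaves the difference quotients unchanged. Consequently a containment
    -- in a union of translates of free sets cannot have all its images in one of them.
    untranslate : ∀ {S} a b → (∀ p → image p ∈ translate a b S) → S Contains P
    untranslate a b image∈S = record
      { fX = record
        { to   = λ (x , y , xy∈P) → value fX x (y , xy∈P) - a , _ , image∈S (_ , xy∈P)
        ; cong = λ {p} {q} x≈x′ → +-congʳ (Func.cong fX {p} {q} x≈x′)
        }
      ; fY = record
        { to   = λ (y , x , xy∈P) → value fY y (x , xy∈P) - b , _ , image∈S (_ , xy∈P)
        ; cong = λ {p} {q} y≈y′ → +-congʳ (Func.cong fY {p} {q} y≈y′)
        }
      ; fX-expands = λ x₀∈ x₁∈ x₁<x₀ → ≤-respʳ-≈
          (*-congʳ (Eq.sym ([x-z]-[y-z]≈x-y _ _ a))) (fX-expands x₀∈ x₁∈ x₁<x₀)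
      ; fY-expands = λ y₀∈ y₁∈ y₁<y₀ → ≤-respʳ-≈
          (*-congʳ (Eq.sym ([x-z]-[y-z]≈x-y _ _ b))) (fY-expands y₀∈ y₁∈ y₁<y₀)
      ; maps-into-S = λ xy∈P → image∈S (_ , xy∈P)
      }

  -- Bipartitions induced by containments.

  -- p # q says that a bipartition of P into a left part and a right part
  -- separates p from q; _≺_ is the order of the y-coordinates from the left
  -- part to the right part.
  record Bipartition (P : Pred ℝ² 0ℓ) (_≺_ : Rel ℝ 0ℓ) : Set₁ where
    infix 4 _#_
    field
      _#_        : Rel (∃ P) 0ℓ
      #-sym      : ∀ {p q} → p # q → q # p
      #-cotrans  : ∀ {p q} → p # q → ∀ r → p # r ⊎ r # q
      nontrivial : ∃[ p ] ∃[ q ] p # q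
      ordered    : ∀ {p q} → p # q →
        let (px , py) = proj₁ p ; (qx , qy) = proj₁ q in
        (px < qx × py ≺ qy) ⊎ (qx < px × qy ≺ py)

  -- Not being separated by `A` is a transitive relation, by cotransitivity, and it holds for every
  -- pair that `D` separates. The pairs separated by `D` connect all the points, so `A` would
  -- separate nothing.
  no-two-bipartitions : ∀ {P} → Bipartition P _<_ → ¬ Bipartition P (flip _<_)
  no-two-bipartitions D A with (p , q , pDq) ← Bipartition.nontrivial D
                          with (s , t , sAt) ← Bipartition.nontrivial A = absurd
    where
    module D = Bipartition D
    module A = Bipartition A

    disjoint : ∀ {p q} → p D.# q → ¬ p A.# q
    disjoint pDq pAq with D.ordered pDq | A.ordered pAq
    ... | inj₁ (_ , py<qy)  | inj₁ (_ , qy<py)  = <-asym py<qy qy<py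
    ... | inj₁ (px<qx , _)  | inj₂ (qx<px , _)  = <-asym px<qx qx<px
    ... | inj₂ (qx<px , _)  | inj₁ (px<qx , _)  = <-asym px<qx qx<px
    ... | inj₂ (_ , qy<py)  | inj₂ (_ , py<qy)  = <-asym py<qy qy<py

    -- `D` separates `r` from `p` or from `q`. Hence `r` is joined to `p` directly or through `q` by
    -- pairs that `D` separates, and `A` separates none of these.
    no-A-neighbour : ∀ {r} → ¬ p A.# r
    no-A-neighbour {r} pAr with D.#-cotrans pDq r | A.#-cotrans pAr q
    ... | inj₁ pDr | _        = disjoint pDr pAr
    ... | inj₂ rDq | inj₁ pAq = disjoint pDq pAq
    ... | inj₂ rDq | inj₂ qAr = disjoint rDq (A.#-sym qAr)

    absurd : ⊥
    absurd with A.#-cotrans sAt p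
    ... | inj₁ sAp = no-A-neighbour (A.#-sym sAp)
    ... | inj₂ pAt = no-A-neighbour pAt

  -- Points of `P` are sorted by the piece that contains their image, and the separation of the
  -- pieces is pulled back along the coordinate maps. The vertical order `≺` is a parameter so that
  -- one argument serves the diagonal, with `_<_`, and the antidiagonal, with `flip _<_`.
  contains-∪⇒bipartition : ∀ {P S T a₁ b₁ a₂ b₂} {_≺_ : Rel ℝ 0ℓ} →
    S IsFreeOf P → T IsFreeOf P →
    (C : (translate a₁ b₁ S ∪ translate a₂ b₂ T) Contains P) →
    let open Image C in
    (∀ {u v} → u ∈ translate a₁ b₁ S → v ∈ translate a₂ b₂ T →
      proj₁ u < proj₁ v × proj₂ u ≺ proj₂ v) →
    (∀ p q → proj₂ (image p) ≺ proj₂ (image q) → proj₂ (proj₁ p) ≺ proj₂ (proj₁ q)) →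
    Bipartition P _≺_
  contains-∪⇒bipartition {P} {S} {T} {a₁} {b₁} {a₂} {b₂} {_≺_}
    S-free T-free C separated reflects-≺ = record
    { _#_        = λ p q → (Left p × Right q) ⊎ (Left q × Right p)
    ; #-sym      = λ { (inj₁ lr) → inj₂ lr ; (inj₂ lr) → inj₁ lr }
    ; #-cotrans  = cotrans
    ; nontrivial = let (p , p∈L) = left-inhabited ; (q , q∈R) = right-inhabited in
                   p , q , inj₁ (p∈L , q∈R)
    ; ordered    = λ { {p} {q} (inj₁ (p∈L , q∈R)) → inj₁ (left-right p q p∈L q∈R)
                     ; {p} {q} (inj₂ (q∈L , p∈R)) → inj₂ (left-right q p q∈L p∈R) }
    }
    where
    open Image C

    Left Right : Pred (∃ P) 0ℓ
    Left  p = image p ∈ translate a₁ b₁ S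
    Right p = image p ∈ translate a₂ b₂ T

    cotrans : ∀ {p q} → (Left p × Right q) ⊎ (Left q × Right p) → ∀ r →
      ((Left p × Right r) ⊎ (Left r × Right p)) ⊎ ((Left r × Right q) ⊎ (Left q × Right r))
    cotrans (inj₁ (p∈L , q∈R)) r with image∈ r
    ... | inj₁ r∈L = inj₂ (inj₁ (r∈L , q∈R))
    ... | inj₂ r∈R = inj₁ (inj₁ (p∈L , r∈R))
    cotrans (inj₂ (q∈L , p∈R)) r with image∈ r
    ... | inj₁ r∈L = inj₁ (inj₂ (r∈L , p∈R))
    ... | inj₂ r∈R = inj₂ (inj₂ (q∈L , r∈R))

    left-inhabited : ∃ Left
    left-inhabited with em {P = ∃ Left}
    ... | yes l = l
    -- With nothing on the left, all images lie in the copy of `T`, and moving them back shows that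
    -- `T` contains `P`.
    ... | no ¬l = ⊥-elim (T-free (untranslate a₂ b₂ all-right))
      where
      all-right : ∀ p → Right p
      all-right p with image∈ p
      ... | inj₁ p∈L = ⊥-elim (¬l (p , p∈L))
      ... | inj₂ p∈R = p∈R

    right-inhabited : ∃ Right
    right-inhabited with em {P = ∃ Right}
    ... | yes r = r
    ... | no ¬r = ⊥-elim (S-free (untranslate a₁ b₁ all-left))
      where
      all-left : ∀ p → Left p
      all-left p with image∈ p
      ... | inj₁ p∈L = p∈L
      ... | inj₂ p∈R = ⊥-elim (¬r (p , p∈R))

    left-right : ∀ p q → Left p → Right q →
      let (px , py) = proj₁ p ; (qx , qy) = proj₁ q in px < qx × py ≺ qy
    left-right p q p∈L q∈R with ix , iy ← separated p∈L q∈R =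
      image-reflects-<ˣ p q ix , reflects-≺ p q iy

  -- The two placements and superadditivity.

  FreeOpen : ℝ → Pred ℝ² 0ℓ → Set₁
  FreeOpen n P = Σ[ S ∈ Pred ℝ² 0ℓ ] IsOpen S × S IsFreeOf P × S ⊆ Square n

  μ₂≼opx : ∀ {k P} (A : FreeOpen k P) → μ₂ (proj₁ A) ≼ opx k P
  μ₂≼opx A = ⨆-upper (λ (S , _) → μ₂ S) A

  module _ (P : Pred ℝ² 0ℓ) {m n : ℝ} (0≤m : 0# ≤ m) (0≤n : 0# ≤ n)
           {S T : Pred ℝ² 0ℓ} (S-open : IsOpen S) (T-open : IsOpen T)
           (S-free : S IsFreeOf P) (T-free : T IsFreeOf P)
           (S⊆□ : S ⊆ Square m) (T⊆□ : T ⊆ Square n) where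

    private
      -- `S` always occupies the left columns and `T` the right ones; only the heights differ.
      -- Writing the zero translations out gives both unions one common shape, so that measure,
      -- openness and horizontal separation are proved once for all heights.
      diagonal antidiagonal : Pred ℝ² 0ℓ
      diagonal     = translate 0# 0# S ∪ translate m m T
      antidiagonal = translate 0# n S ∪ translate m 0# T

      n+m≤m+n : n + m ≤ m + n
      n+m≤m+n = ≤-reflexive (+-comm n m)

      m+0≤m+n : m + 0# ≤ m + n
      m+0≤m+n = +-monoʳ-≤ m 0≤n

      n+0≤m+n : n + 0# ≤ m + n
      n+0≤m+n = begin
        n + 0#  ≤⟨ +-monoʳ-≤ n 0≤m ⟩
        n + m   ≤⟨ n+m≤m+n ⟩
        m + n   ∎

      diagonal-⊆ : diagonal ⊆ Square (m + n)
      diagonal-⊆ (inj₁ p∈) = translate-⊆-Square ≤-refl m+0≤m+n ≤-refl m+0≤m+n S⊆□ p∈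
      diagonal-⊆ (inj₂ p∈) = translate-⊆-Square 0≤m n+m≤m+n 0≤m n+m≤m+n T⊆□ p∈

      antidiagonal-⊆ : antidiagonal ⊆ Square (m + n)
      antidiagonal-⊆ (inj₁ p∈) = translate-⊆-Square ≤-refl m+0≤m+n 0≤n ≤-refl S⊆□ p∈
      antidiagonal-⊆ (inj₂ p∈) = translate-⊆-Square 0≤m n+m≤m+n ≤-refl n+0≤m+n T⊆□ p∈

      separatedˣ : ∀ b₁ b₂ {u v} → u ∈ translate 0# b₁ S → v ∈ translate m b₂ T → proj₁ u < proj₁ v
      separatedˣ _ _ u∈ v∈ =
        x-0<k∧0≤y-k⇒x<y (proj₁ (open-⊆-Square⇒< S-open S⊆□ u∈)) (proj₁ (proj₁ (T⊆□ v∈)))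

      μ₂-placed : ∀ b₁ b₂ → μ₂ S ⊕ μ₂ T ≼ μ₂ (translate 0# b₁ S ∪ translate m b₂ T)
      μ₂-placed b₁ b₂ = ≼-trans
        (⊕-mono (μ₂-translate 0# b₁ S-open) (μ₂-translate m b₂ T-open))
        (μ₂-∪ m
          (λ { {x , _} p∈ → ≤-respʳ-≈ (+-identityʳ m) (x-z≤y⇒x≤y+z (proj₂ (proj₁ (S⊆□ p∈)))) })
          (λ p∈ → 0≤y-x⇒x≤y (proj₁ (proj₁ (T⊆□ p∈)))))

      placed-open : ∀ b₁ b₂ → IsOpen (translate 0# b₁ S ∪ translate m b₂ T)
      placed-open b₁ b₂ = ∪-open (λ {p} → translate-open 0# b₁ S-open {p})
                                 (λ {p} → translate-open m b₂ T-open {p})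

      not-both : diagonal Contains P → antidiagonal IsFreeOf P
      not-both D A = no-two-bipartitions
        (contains-∪⇒bipartition S-free T-free D
          (λ u∈ v∈ → separatedˣ 0# m u∈ v∈ ,
            x-0<k∧0≤y-k⇒x<y (proj₂ (open-⊆-Square⇒< S-open S⊆□ u∈)) (proj₁ (proj₂ (T⊆□ v∈))))
          (Image.image-reflects-<ʸ D))
        (contains-∪⇒bipartition S-free T-free A
          (λ u∈ v∈ → separatedˣ n 0# u∈ v∈ ,
            -- Vertically the sets trade places: the copy of `T` lies strictly below height `n` and
            -- the copy of `S` at or above it.
            x-0<k∧0≤y-k⇒x<y (proj₂ (open-⊆-Square⇒< T-open T⊆□ v∈)) (proj₁ (proj₂ (S⊆□ u∈))))
          (λ p q → Image.image-reflects-<ʸ A q p))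

    μ₂⊕μ₂≼opx : μ₂ S ⊕ μ₂ T ≼ opx (m + n) P
    μ₂⊕μ₂≼opx with em {P = diagonal Contains P}
    ... | no D-free = ≼-trans (μ₂-placed 0# m)
            (μ₂≼opx (diagonal , (λ {p} → placed-open 0# m {p}) , D-free , λ {p} → diagonal-⊆ {p}))
    ... | yes D     = ≼-trans (μ₂-placed n 0#)
            (μ₂≼opx (antidiagonal , (λ {p} → placed-open n 0# {p}) , not-both D , λ {p} → antidiagonal-⊆ {p}))

  -- Empty functions show that every set contains an empty `P`, so the supremum is over an empty
  -- family.
  opx-empty : ∀ {P} → ¬ ∃ P → ∀ n → opx n P ≼ 0∞
  opx-empty {P} ¬p n = ⨆-least _ λ (S , _ , S-free , _) → ⊥-elim (S-free record
    { fX          = record { to = λ (x , y , xy∈P) → ⊥-elim (¬p (_ , xy∈P))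
                           ; cong = λ { {_ , _ , xy∈P} → ⊥-elim (¬p (_ , xy∈P)) } }
    ; fY          = record { to = λ (y , x , xy∈P) → ⊥-elim (¬p (_ , xy∈P))
                           ; cong = λ { {_ , _ , xy∈P} → ⊥-elim (¬p (_ , xy∈P)) } }
    ; fX-expands  = λ (_ , xy∈P) → ⊥-elim (¬p (_ , xy∈P))
    ; fY-expands  = λ (_ , xy∈P) → ⊥-elim (¬p (_ , xy∈P))
    ; maps-into-S = λ xy∈P → ⊥-elim (¬p (_ , xy∈P))
    })

  -- For inhabited `P` this supplies the indices that `⨆⊕⨆-least` asks for.
  ∅-freeOpen : ∀ {P} → ∃ P → ∀ n → FreeOpen n P
  ∅-freeOpen (_ , xy∈P) n = ∅ , (λ ()) , (λ C → _Contains_.maps-into-S C xy∈P) , λ ()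

  0∞≼ : ∀ a → 0∞ ≼ a
  0∞≼ (fin _ 0≤r) = fin≼fin 0≤r
  0∞≼ ∞           = ≼∞

  opx-superadditive : ∀ P m n → 0# ≤ m → 0# ≤ n → opx m P ⊕ opx n P ≼ opx (m + n) P
  opx-superadditive P m n 0≤m 0≤n with em {P = ∃ P}
  ... | yes p = ⨆⊕⨆-least _ _ (∅-freeOpen p m) (∅-freeOpen p n)
      λ (_ , S-open , S-free , S⊆□) (_ , T-open , T-free , T⊆□) →
        μ₂⊕μ₂≼opx P 0≤m 0≤n S-open T-open S-free T-free S⊆□ T⊆□
  ... | no ¬p = ≼-trans (⊕-mono (opx-empty ¬p m) (opx-empty ¬p n))
                (≼-trans (fin≼fin (≤-reflexive (+-identityˡ 0#))) (0∞≼ _))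

lemma2p5 : (em : ∀ {ℓ} → ExcludedMiddle ℓ) (R : Reals) →
    let open Plane em R in
    (P : Pred ℝ² 0ℓ) (m n : ℝ) → 0# < m → 0# < n →
    opx m P ⊕ opx n P ≼ opx (m + n) P
lemma2p5 em R P m n (0≤m , _) (0≤n , _) = opx-superadditive em R P m n 0≤m 0≤n
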